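{- Let $m,n\ge 2$. If $C$ is any maximal configuration on the $m\times n$ grid, then $$|C|\ge I_{m,n}\ge\begin{cases}\frac{mn}{2}+2, & \text{if } n\equiv 0 \pmod 4,\\ \frac{m(n+2)}{2}, & \text{if } n\equiv 2\pmod 4,\\ \frac{m(n+1)}{2}+1, & \text{if } n\equiv 1\pmod 2.\end{cases}$$
   Context: The $m\times n$ grid is $[m]\times[n]=\{(i,j):1\le i\le m,\ 1\le j\le n\}$; $(i,j)$ is the lot in row $i$ and column $j$, rows counted from the north (row $m$ southernmost) and columns from the west. A configuration is a subset $C\subseteq[m]\times[n]$ (the occupied lots); $|C|$ is its occupancy. A house at $(i,j)\in C$ is blocked from sunlight if $(i,j+1)$, $(i,j-1)$, $(i+1,j)$ all lie in the grid and are all occupied (lots outside the grid never obstruct sunlight). A configuration is permissible if no house in it is blocked; it is maximal if it is permissible and no permissible configuration strictly contains it. $I_{m,n}$ denotes the minimum of $|C|$ over all maximal configurations $C$ on the $m\times n$ grid. -}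

module Defs where

open import Data.Nat using (ℕ; suc; _≤_)
open import Data.Fin using (Fin; toℕ)
open import Data.Bool using (Bool; true; false; if_then_else_)
open import Data.List using (List; map; allFin)
open import Data.Nat.ListAction using (sum)
open import Data.Product using (_×_; Σ; ∃; ∃-syntax)
open import Relation.Nullary using (¬_)
open import Relation.Binary.PropositionalEquality using (_≡_)

-- A configuration on the m×n grid: C i j = true iff lot (i,j) is occupied.
-- Indices are 0-based: row i (0 = northernmost, increasing southward),
-- column j (0 = westernmost, increasing eastward).
Config : ℕ → ℕ → Set
Config m n = Fin m → Fin n → Bool

Occ : ∀ {m n} → Config m n → Fin m → Fin n → Set
Occ C i j = C i j ≡ true

Blocked : ∀ {m n} → Config m n → Fin m → Fin n → Set
Blocked C i j =
  Occ C i j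
  × (∃[ e ] (toℕ e ≡ suc (toℕ j) × Occ C i e))
  × (∃[ w ] (suc (toℕ w) ≡ toℕ j × Occ C i w))
  × (∃[ s ] (toℕ s ≡ suc (toℕ i) × Occ C s j))

Permissible : ∀ {m n} → Config m n → Set
Permissible C = ∀ i j → ¬ Blocked C i j

_⊆C_ : ∀ {m n} → Config m n → Config m n → Set
C ⊆C D = ∀ i j → Occ C i j → Occ D i j

Maximal : ∀ {m n} → Config m n → Set
Maximal C = Permissible C × (∀ D → Permissible D → C ⊆C D → D ⊆C C)

occupancy : ∀ {m n} → Config m n → ℕ
occupancy {m} {n} C =
  sum (map (λ i → sum (map (λ j → if C i j then 1 else 0) (allFin n))) (allFin m))

IsI : ℕ → ℕ → ℕ → Set
IsI m n k =
  (Σ (Config m n) λ C → Maximal C × occupancy C ≡ k)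
  × (∀ (C : Config m n) → Maximal C → k ≤ occupancy C)

{-# OPTIONS --safe #-}
module Submission where

open import Defs
open import Data.Bool using (Bool; true; false; if_then_else_; T; T?; _∧_; _∨_)
open import Data.Bool.Properties using (T-≡; T-∧; T-∨; ∧-zeroʳ; ∨-zeroʳ; ∨-identityʳ)
open import Data.Fin using (Fin; zero; suc; toℕ; fromℕ<; _≟_)
open import Data.Fin.Patterns using (0F; 1F; 2F; 3F)
open import Data.Fin.Properties using (toℕ-fromℕ<)
open import Data.List using (allFin; map; tabulate)
open import Data.List.Properties using (map-tabulate)
open import Data.Nat using (ℕ; _≤_; _+_; _*_; _%_; zero; suc; _<_; z≤n; s≤s; _≤?_)
open import Data.Nat.Divisibility using (divides)
open import Data.Nat.DivMod using (_divMod_; result; [m+kn]%n≡m%n; m∣n⇒o%n%m≡o%m)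
open import Data.Nat.ListAction using (sum)
open import Data.Nat.Properties hiding (_≟_)
open import Data.Nat.Tactic.RingSolver using (solve-∀)
open import Data.Product using (_×_; _,_; proj₁; proj₂)
open import Data.Sum using (_⊎_; inj₁; inj₂)
open import Function using (_∘_; _$_; const; id; Equivalence)
open import Relation.Binary.PropositionalEquality
  using (_≡_; refl; sym; trans; cong; cong₂; cong-app; subst; subst₂)
open import Relation.Nullary using (Dec; yes; no; ¬_; contradiction)
open import Relation.Nullary.Decidable
  using (does; _×-dec_; _→-dec_; map′; from-yes; decidable-stable)

-- Call a house interior if both its east and west neighbours are occupied. An empty lot
-- of a maximal configuration lies south of an interior house, or has one of the patterns
-- 1_1, 11_, _11 around it in its own row. Number the columns from 0 and cut each row into
-- the blocks 4k-1, …, 4k+2 (column -1 being empty). Each full block has at least two houses,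
-- where those of its two middle lots that are interior do not count and the middle lots
-- lying south of an interior house count once more. The credit passes from each row to
-- the next, so it telescopes: a row has on average at least n/2, (n+1)/2 or (n+2)/2
-- houses. The last two rows are treated apart: in the last row every empty lot lies south
-- of an interior house, and the row before it has at least two houses that are not
-- interior, hence together they have at least n+2.

-- Counting houses in one row, block by block.

∀-bool? : {P : Bool → Set} → (∀ b → Dec (P b)) → Dec (∀ b → P b)
∀-bool? P? = map′ (λ { (f , t) false → f ; (f , t) true → t })
                  (λ p → p false , p true) (P? false ×-dec P? true)

bit : Bool → ℕ
bit b = if b then 1 else 0

total : (ℕ → ℕ) → ℕ → ℕ
total f zero    = 0
total f (suc n) = f 0 + total (f ∘ suc) n

count : (ℕ → Bool) → ℕ → ℕ
count y = total (bit ∘ y)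

-- A row is a sequence ℕ → Bool whose lot j sits at index 2 + j; indices 0, 1 and
-- those beyond the last lot are false, as lots outside the grid obstruct nothing.
-- Accordingly interior y j speaks about the lot at index 1 + j.
interior : (ℕ → Bool) → ℕ → Bool
interior y j = y j ∧ y (1 + j) ∧ y (2 + j)

-- The lot x, with two neighbours on each side, is occupied, or a house there would
-- block its northern neighbour, itself, its western or its eastern neighbour; the
-- occupied southern lot that the last three also require plays no role in the count.
justified : (w₂ w₁ x e₁ e₂ north : Bool) → Bool
justified w₂ w₁ x e₁ e₂ north = x ∨ north ∨ (w₁ ∧ e₁) ∨ (w₂ ∧ w₁) ∨ (e₁ ∧ e₂)

Justified : (z y : ℕ → Bool) → ℕ → Set
Justified z y j =
  T (justified (y j) (y (1 + j)) (y (2 + j)) (y (3 + j)) (y (4 + j)) (interior z (1 + j)))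

-- Indices 2 and 3 of the (shifted) row are the middle lots of a block.
middle : (ℕ → Bool) → ℕ → ℕ
middle y zero    = 0
middle y (suc k) = (bit (interior y 1) + bit (interior y 2)) + middle (y ∘ (4 +_)) k

-- One interior middle lot forces three houses in the block, two force all four. Otherwise each
-- empty middle lot yields a unit of its own: credit from the north or a house at an end of the
-- block. If both are empty, `y 1` can serve only the western one and `y 4` only the eastern one.
block-bound : ∀ z y → Justified z y 0 → Justified z y 1 →
  2 + (bit (interior y 1) + bit (interior y 2)) ≤
  (bit (y 1) + (bit (y 2) + (bit (y 3) + bit (y 4)))) + (bit (interior z 1) + bit (interior z 2))
block-bound z y = from-yes block? (y 0) (y 1) (y 2) (y 3) (y 4) (y 5) (interior z 1) (interior z 2)
  where
  block? =
    ∀-bool? λ a → ∀-bool? λ b → ∀-bool? λ c → ∀-bool? λ d →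
    ∀-bool? λ e → ∀-bool? λ f → ∀-bool? λ p → ∀-bool? λ q →
    T? (justified a b c d e p) →-dec T? (justified b c d e f q) →-dec
    2 + (bit (b ∧ c ∧ d) + bit (c ∧ d ∧ e)) ≤?
    (bit b + (bit c + (bit d + bit e))) + (bit p + bit q)

tail-bound-0 : ∀ b {c d} e → c ≡ false → d ≡ false →
  bit (b ∧ c ∧ d) + bit (c ∧ d ∧ e) ≤ bit b
tail-bound-0 false e refl refl = z≤n
tail-bound-0 true  e refl refl = z≤n

-- The grid ends at `c`. If `c` is empty, nothing east of it can justify it, so either the north
-- gives credit or `b` is a house.
tail-bound-1 : ∀ a b c {d} e p → T (justified a b c d e p) → d ≡ false →
  1 + (bit (b ∧ c ∧ d) + bit (c ∧ d ∧ e)) ≤ (bit b + bit c) + bit p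
tail-bound-1 a     true  true  e p     _ refl = s≤s z≤n
tail-bound-1 a     true  false e p     _ refl = s≤s z≤n
tail-bound-1 a     false true  e p     _ refl = s≤s z≤n
tail-bound-1 a     false false e true  _ refl = s≤s z≤n
tail-bound-1 true  false false e false () refl
tail-bound-1 false false false e false () refl

-- One house for each middle lot of the last, truncated block that lies in the grid.
tail : Fin 4 → ℕ
tail 0F = 0
tail 1F = 1
tail 2F = 2
tail 3F = 2

-- Indices 0 and 1 of `y` are arbitrary, so that the induction can strip a block and continue with
-- both rows shifted by 4. The count starts at index 1, the first lot of a block.
row-bound : ∀ q r z y →
  (∀ j → j < q * 4 + toℕ r → Justified z y j) →
  (∀ j → q * 4 + toℕ r ≤ j → y (2 + j) ≡ false) →
  (q * 2 + tail r) + middle y (suc q) ≤ count (y ∘ suc) (suc (q * 4 + toℕ r)) + middle z (suc q)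
row-bound zero 0F z y _ out = begin
  (u + 0)                       ≡⟨ +-identityʳ u ⟩
  u                             ≤⟨ tail-bound-0 (y 1) (y 4) (out 0 z≤n) (out 1 z≤n) ⟩
  bit (y 1)                     ≡⟨ +-identityʳ _ ⟨
  bit (y 1) + 0                 ≤⟨ m≤m+n _ _ ⟩
  bit (y 1) + 0 + middle z 1    ∎
  where
  open ≤-Reasoning
  u = bit (interior y 1) + bit (interior y 2)
row-bound zero 1F z y just out = begin
  1 + (u + 0)                   ≡⟨ cong suc (+-identityʳ u) ⟩
  1 + u                         ≤⟨ tail-bound-1 (y 0) (y 1) (y 2) (y 4) (interior z 1)
                                     (just 0 (s≤s z≤n)) (out 1 (s≤s z≤n)) ⟩
  (bit (y 1) + bit (y 2)) + p   ≤⟨ m≤m+n _ _ ⟩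
  (bit (y 1) + bit (y 2)) + p + v  ≡⟨ rearrange (bit (y 1)) (bit (y 2)) p v ⟩
  bit (y 1) + (bit (y 2) + 0) + middle z 1  ∎
  where
  open ≤-Reasoning
  u = bit (interior y 1) + bit (interior y 2)
  p = bit (interior z 1)
  v = bit (interior z 2)
  rearrange : ∀ b c p v → (b + c) + p + v ≡ b + (c + 0) + ((p + v) + 0)
  rearrange = solve-∀
row-bound zero 2F z y just out = begin
  2 + (u + 0)                   ≡⟨ cong (2 +_) (+-identityʳ u) ⟩
  -- Both middle lots lie in the grid, so the bound for a full block applies; its fourth lot lies
  -- just beyond the east edge and counts 0.
  2 + u                         ≤⟨ block-bound z y (just 0 (s≤s z≤n)) (just 1 (s≤s (s≤s z≤n))) ⟩
  (bit (y 1) + (bit (y 2) + (bit (y 3) + bit (y 4)))) + v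
    ≡⟨ cong₂ _+_ (cong (λ e → bit (y 1) + (bit (y 2) + (bit (y 3) + bit e))) (out 2 ≤-refl))
                 (sym (+-identityʳ v)) ⟩
  (bit (y 1) + (bit (y 2) + (bit (y 3) + 0))) + middle z 1  ∎
  where
  open ≤-Reasoning
  u = bit (interior y 1) + bit (interior y 2)
  v = bit (interior z 1) + bit (interior z 2)
row-bound zero 3F z y just out = begin
  2 + (u + 0)                   ≡⟨ cong (2 +_) (+-identityʳ u) ⟩
  2 + u                         ≤⟨ block-bound z y (just 0 (s≤s z≤n)) (just 1 (s≤s (s≤s z≤n))) ⟩
  (bit (y 1) + (bit (y 2) + (bit (y 3) + bit (y 4)))) + v
    ≡⟨ rearrange (bit (y 1)) (bit (y 2)) (bit (y 3)) (bit (y 4)) v ⟩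
  (bit (y 1) + (bit (y 2) + (bit (y 3) + (bit (y 4) + 0)))) + middle z 1  ∎
  where
  open ≤-Reasoning
  u = bit (interior y 1) + bit (interior y 2)
  v = bit (interior z 1) + bit (interior z 2)
  rearrange : ∀ b c d e v → (b + (c + (d + e))) + v ≡ (b + (c + (d + (e + 0)))) + (v + 0)
  rearrange = solve-∀
row-bound (suc q) r z y just out = begin
  (2 + q * 2 + tail r) + (u + mu)   ≡⟨ split (q * 2 + tail r) u mu ⟩
  (2 + u) + (q * 2 + tail r + mu)   ≤⟨ +-mono-≤
      (block-bound z y (just 0 (s≤s z≤n)) (just 1 (s≤s (s≤s z≤n))))
      (row-bound q r (z ∘ (4 +_)) (y ∘ (4 +_))
        (λ j j< → just (4 + j) (+-monoʳ-< 4 j<)) (λ j ≤j → out (4 + j) (+-monoʳ-≤ 4 ≤j))) ⟩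
  ((b + (c + (d + e))) + v) + (rest + mv)   ≡⟨ merge b c d e v rest mv ⟩
  (b + (c + (d + (e + rest)))) + (v + mv)   ∎
  where
  open ≤-Reasoning
  b = bit (y 1)
  c = bit (y 2)
  d = bit (y 3)
  e = bit (y 4)
  u = bit (interior y 1) + bit (interior y 2)
  v = bit (interior z 1) + bit (interior z 2)
  mu = middle (y ∘ (4 +_)) (suc q)
  mv = middle (z ∘ (4 +_)) (suc q)
  rest = count (y ∘ (5 +_)) (suc (q * 4 + toℕ r))
  split : ∀ k u mu → (2 + k) + (u + mu) ≡ (2 + u) + (k + mu)
  split = solve-∀
  merge : ∀ b c d e v s mv →
    ((b + (c + (d + e))) + v) + (s + mv) ≡ (b + (c + (d + (e + s)))) + (v + mv)
  merge = solve-∀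

-- The last two rows.

total-mono : ∀ {f g} n → (∀ j → j < n → f j ≤ g j) → total f n ≤ total g n
total-mono zero    f≤g = z≤n
total-mono (suc n) f≤g =
  +-mono-≤ (f≤g 0 (s≤s z≤n)) (total-mono n λ j j< → f≤g (suc j) (s≤s j<))

bit-∧-≤ : ∀ a b c → bit (a ∧ b ∧ c) ≤ bit b
bit-∧-≤ false b     c     = z≤n
bit-∧-≤ true  false c     = z≤n
bit-∧-≤ true  true  false = z≤n
bit-∧-≤ true  true  true  = ≤-refl

-- The eastern end of a run is not interior.
interior<houses : ∀ n y k → k < n → y (1 + k) ≡ true → y (1 + n) ≡ false →
  suc (count (interior y) n) ≤ count (y ∘ suc) n
interior<houses (suc n) y (suc k) (s≤s k<n) yk yn = begin
  suc (bit (interior y 0) + count (interior (y ∘ suc)) n)  ≡⟨ +-suc (bit (interior y 0)) _ ⟨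
  bit (interior y 0) + suc (count (interior (y ∘ suc)) n)
    ≤⟨ +-mono-≤ (bit-∧-≤ (y 0) (y 1) (y 2)) (interior<houses n (y ∘ suc) k k<n yk yn) ⟩
  bit (y 1) + count (y ∘ (2 +_)) n  ∎
  where open ≤-Reasoning
interior<houses (suc n) y zero _ yk yn with y 2 in y2
interior<houses (suc zero)    y zero _ yk yn | true = contradiction (trans (sym yn) y2) λ ()
interior<houses (suc (suc n)) y zero _ yk yn | true = begin
  suc (bit (y 0 ∧ y 1 ∧ true) + count (interior (y ∘ suc)) (suc n))
    ≡⟨ +-suc (bit (y 0 ∧ y 1 ∧ true)) _ ⟨
  bit (y 0 ∧ y 1 ∧ true) + suc (count (interior (y ∘ suc)) (suc n))
    ≤⟨ +-mono-≤ (bit-∧-≤ (y 0) (y 1) true) (interior<houses (suc n) (y ∘ suc) 0 (s≤s z≤n) y2 yn) ⟩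
  bit (y 1) + count (y ∘ (2 +_)) (suc n)  ∎
  where open ≤-Reasoning
interior<houses (suc n) y zero _ yk yn | false
  rewrite yk | ∧-zeroʳ (y 0) =
  s≤s (total-mono n λ j _ → bit-∧-≤ (y (1 + j)) (y (2 + j)) (y (3 + j)))

covered : ∀ n (f g : ℕ → Bool) → (∀ j → j < n → T (f j ∨ g j)) → n ≤ count f n + count g n
covered zero    f g f∨g = z≤n
covered (suc n) f g f∨g = begin
  suc n                                     ≤⟨ +-mono-≤ (one (f 0) (g 0) (f∨g 0 (s≤s z≤n)))
                                                 (covered n (f ∘ suc) (g ∘ suc) λ j j< → f∨g (suc j) (s≤s j<)) ⟩
  (bit (f 0) + bit (g 0)) + (count (f ∘ suc) n + count (g ∘ suc) n)
                                            ≡⟨ interchange (bit (f 0)) (bit (g 0)) _ _ ⟩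
  count f (suc n) + count g (suc n)         ∎
  where
  open ≤-Reasoning
  one : ∀ a b → T (a ∨ b) → 1 ≤ bit a + bit b
  one true  b    _ = s≤s z≤n
  one false true _ = s≤s z≤n
  interchange : ∀ a b c d → (a + b) + (c + d) ≡ (a + c) + (b + d)
  interchange = solve-∀

Bordered : ℕ → (ℕ → Bool) → Set
Bordered n y = y 1 ≡ false × (∀ j → n ≤ j → y (2 + j) ≡ false)

-- Every other justification of the first lot would use the empty column west of the grid.
west-edge : ∀ {n} z y → Bordered n z → Bordered n y → Justified z y 0 → T (y 2 ∨ (y 3 ∧ y 4))
west-edge z y (z1 , _) (y1 , _) just rewrite z1 | y1 = drop (y 0) (y 2) _ just
  where
  drop : ∀ a x t → T (x ∨ (a ∧ false) ∨ t) → T (x ∨ t)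
  drop true  x t h = h
  drop false x t h = h

east-edge : ∀ {n} z y → Bordered (suc n) z → Bordered (suc n) y →
  Justified z y n → T (y (2 + n) ∨ (y n ∧ y (1 + n)))
east-edge {n} z y (_ , z-out) (_ , y-out) just
  rewrite z-out (suc n) ≤-refl | y-out (suc n) ≤-refl =
  drop (y (2 + n)) (z (1 + n)) (z (2 + n)) (y n) (y (1 + n)) just
  where
  drop : ∀ x p q a b → T (x ∨ (p ∧ q ∧ false) ∨ (b ∧ false) ∨ (a ∧ b) ∨ false) → T (x ∨ (a ∧ b))
  drop x p q a b h
    rewrite ∧-zeroʳ q | ∧-zeroʳ p | ∧-zeroʳ b | ∨-identityʳ (a ∧ b) = h

T⇒≡ : ∀ {b} → T b → b ≡ true
T⇒≡ = Equivalence.to T-≡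

T-∧⁻ : ∀ a {b} → T (a ∧ b) → a ≡ true × b ≡ true
T-∧⁻ a ab = T⇒≡ (proj₁ both) , T⇒≡ (proj₂ both)
  where both = Equivalence.to (T-∧ {a}) ab

-- The two houses that are not interior are the westernmost one and the eastern end of a run further
-- east. By `west-edge` the former is in column 0 or 1. A house further east comes from `east-edge`
-- if it is in column 0, and is the occupied lot of column 2 if it is in column 1.
two-ends : ∀ n z y → 2 ≤ n → Bordered n z → Bordered n y → (∀ j → j < n → Justified z y j) →
  2 + count (interior y ∘ suc) n ≤ count (y ∘ (2 +_)) n
two-ends (suc (suc n)) z y (s≤s (s≤s z≤n)) bz by@(y1 , out) just =
  split (y 2) refl (west-edge z y bz by (just 0 (s≤s z≤n)))
  where
  after-house : suc (count (interior (y ∘ (2 +_))) (suc n)) ≤ count (y ∘ (3 +_)) (suc n)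
  after-house with Equivalence.to (T-∨ {y (3 + n)}) (east-edge z y bz by (just (suc n) ≤-refl))
  ... | inj₁ t = interior<houses (suc n) (y ∘ (2 +_)) n ≤-refl (T⇒≡ t) (out (2 + n) ≤-refl)
  ... | inj₂ t = run n out (T-∧⁻ (y (1 + n)) t)
    where
    run : ∀ n → (∀ j → 2 + n ≤ j → y (2 + j) ≡ false) → y (1 + n) ≡ true × y (2 + n) ≡ true →
      suc (count (interior (y ∘ (2 +_))) (suc n)) ≤ count (y ∘ (3 +_)) (suc n)
    -- With two columns, the second lot west of the last one is already outside the grid.
    run zero    _   (t , _) = contradiction (trans (sym y1) t) λ ()
    run (suc n) out (_ , t) =
      interior<houses (2 + n) (y ∘ (2 +_)) n (s≤s (n≤1+n n)) t (out (3 + n) ≤-refl)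

  after-gap : ∀ n → (∀ j → 2 + n ≤ j → y (2 + j) ≡ false) → y 4 ≡ true →
    suc (count (interior (y ∘ (3 +_))) n) ≤ count (y ∘ (4 +_)) n
  after-gap zero    out y4 = contradiction (trans (sym (out 2 ≤-refl)) y4) λ ()
  after-gap (suc n) out y4 =
    interior<houses (suc n) (y ∘ (3 +_)) 0 (s≤s z≤n) y4 (out (3 + n) ≤-refl)

  split : ∀ b → y 2 ≡ b → T (b ∨ (y 3 ∧ y 4)) →
    2 + count (interior y ∘ suc) (2 + n) ≤ count (y ∘ (2 +_)) (2 + n)
  split true  y2 _  rewrite y1 =
    ≤-trans (s≤s after-house) (+-monoˡ-≤ _ (≤-reflexive (cong bit (sym y2))))
  split false y2 t
    rewrite y1 | y2 | proj₁ (T-∧⁻ (y 3) t) = s≤s (after-gap n out (proj₂ (T-∧⁻ (y 3) t)))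

last-rows : ∀ n z y w → 2 ≤ n → Bordered n z → Bordered n y → (∀ j → j < n → Justified z y j) →
  (∀ j → j < n → T (w (2 + j) ∨ interior y (1 + j))) →
  n + 2 ≤ count (y ∘ (2 +_)) n + count (w ∘ (2 +_)) n
last-rows n z y w 2≤n bz by just roofed = begin
  n + 2                                  ≤⟨ +-monoˡ-≤ 2 (covered n (w ∘ (2 +_)) (interior y ∘ suc) roofed) ⟩
  houses w + count (interior y ∘ suc) n + 2  ≡⟨ swap (houses w) _ ⟩
  (2 + count (interior y ∘ suc) n) + houses w  ≤⟨ +-monoˡ-≤ (houses w) (two-ends n z y 2≤n bz by just) ⟩
  houses y + houses w                    ∎
  where
  open ≤-Reasoning
  houses : (ℕ → Bool) → ℕ
  houses x = count (x ∘ (2 +_)) n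
  swap : ∀ a b → a + b + 2 ≡ (2 + b) + a
  swap = solve-∀

-- Summation over the rows.

-- Think of `f i` as the houses of a row and of `t i` as the credit it receives. Summing the steps
-- cancels all credits but `t 0` and `t k`, and the latter is left as slack.
telescope : ∀ β l k (f t : ℕ → ℕ) → (∀ i → i < k → β + t (suc i) ≤ f i + t i) →
  l ≤ f k + f (suc k) → k * β + l ≤ total f (2 + k) + t 0
telescope β l zero f t step end = begin
  l                          ≤⟨ end ⟩
  f 0 + f 1                  ≡⟨ cong (f 0 +_) (+-identityʳ (f 1)) ⟨
  f 0 + (f 1 + 0)            ≤⟨ m≤m+n _ (t 0) ⟩
  f 0 + (f 1 + 0) + t 0      ∎
  where open ≤-Reasoning
telescope β l (suc k) f t step end = begin
  β + k * β + l              ≡⟨ +-assoc β (k * β) l ⟩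
  β + (k * β + l)            ≤⟨ +-monoʳ-≤ β (telescope β l k (f ∘ suc) (t ∘ suc)
                                  (λ i i< → step (suc i) (s≤s i<)) end) ⟩
  β + (rest + t 1)           ≡⟨ swap β rest (t 1) ⟩
  (β + t 1) + rest           ≤⟨ +-monoˡ-≤ rest (step 0 (s≤s z≤n)) ⟩
  (f 0 + t 0) + rest         ≡⟨ swap′ (f 0) (t 0) rest ⟩
  f 0 + rest + t 0           ∎
  where
  open ≤-Reasoning
  rest = total (f ∘ suc) (2 + k)
  swap : ∀ a b c → a + (b + c) ≡ (a + c) + b
  swap = solve-∀
  swap′ : ∀ a b c → (a + b) + c ≡ (a + c) + b
  swap′ = solve-∀

-- Configurations as unbounded grids.

extend : ∀ {n} {A : Set} → (Fin n → A) → A → ℕ → A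
extend {zero}  f a j       = a
extend {suc n} f a zero    = f zero
extend {suc n} f a (suc j) = extend (f ∘ suc) a j

extend-toℕ : ∀ {n} {A : Set} (f : Fin n → A) a j → extend f a (toℕ j) ≡ f j
extend-toℕ f a zero    = refl
extend-toℕ f a (suc j) = extend-toℕ (f ∘ suc) a j

extend-outside : ∀ {n} {A : Set} (f : Fin n → A) a j → n ≤ j → extend f a j ≡ a
extend-outside {zero}  f a j       _         = refl
extend-outside {suc n} f a (suc j) (s≤s n≤j) = extend-outside (f ∘ suc) a j n≤j

extend-all : ∀ {n} {A : Set} (P : A → Set) {f : Fin n → A} {a} →
  (∀ k → P (f k)) → P a → ∀ j → P (extend f a j)
extend-all {zero}  P pf pa j       = pa
extend-all {suc n} P pf pa zero    = pf zero
extend-all {suc n} P pf pa (suc j) = extend-all P (pf ∘ suc) pa j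

-- Two empty lots are put in front because `justified` looks two lots to the west.
pad : (ℕ → Bool) → ℕ → Bool
pad y zero          = false
pad y (suc zero)    = false
pad y (suc (suc j)) = y j

-- Row i of the configuration is row 1 + i here, below an empty row 0.
grid : ∀ {m n} → Config m n → ℕ → ℕ → Bool
grid C zero    = const false
grid C (suc i) = pad (extend (λ a → extend (C a) false) (const false) i)

grid-bordered : ∀ {m n} (C : Config m n) i → Bordered n (grid C i)
grid-bordered C zero    = refl , λ _ _ → refl
grid-bordered {n = n} C (suc i) = refl , λ j n≤j →
  extend-all (λ y → y j ≡ false) {f = λ a → extend (C a) false} {a = const false}
    (λ a → extend-outside (C a) false j n≤j) refl i

grid-below : ∀ {m n} (C : Config m n) i j → m ≤ i → grid C (suc i) j ≡ false
grid-below C i zero          m≤i = refl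
grid-below C i (suc zero)    m≤i = refl
grid-below C i (suc (suc j)) m≤i = cong-app (extend-outside _ _ i m≤i) j

cell : ∀ {m n} (C : Config m n) a b → grid C (suc (toℕ a)) (2 + toℕ b) ≡ C a b
cell C a b = trans (cong-app (extend-toℕ _ _ a) (toℕ b)) (extend-toℕ (C a) false b)

occupied : ∀ {m n} (C : Config m n) {a b i j} →
  suc (toℕ a) ≡ i → 2 + toℕ b ≡ j → Occ C a b → T (grid C i j)
occupied C {a} {b} refl refl occ = Equivalence.from T-≡ (trans (cell C a b) occ)

sum-allFin : ∀ n (f : Fin n → ℕ) g → (∀ j → f j ≡ g (toℕ j)) → sum (map f (allFin n)) ≡ total g n
sum-allFin n f g f≗g = trans (cong sum (map-tabulate id f)) (sum-tabulate n f g f≗g)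
  where
  sum-tabulate : ∀ n (f : Fin n → ℕ) g → (∀ j → f j ≡ g (toℕ j)) → sum (tabulate f) ≡ total g n
  sum-tabulate zero    f g f≗g = refl
  sum-tabulate (suc n) f g f≗g =
    cong₂ _+_ (f≗g zero) (sum-tabulate n (f ∘ suc) (g ∘ suc) (f≗g ∘ suc))

occupancy-grid : ∀ {m n} (C : Config m n) →
  occupancy C ≡ total (λ i → count (grid C (suc i) ∘ (2 +_)) n) m
occupancy-grid {m} {n} C = sum-allFin m _ _ λ a → sum-allFin n _ _ λ b → cong bit (sym (cell C a b))

-- Consequences of maximality, by adding one house.

add : ∀ {m n} → Config m n → Fin m → Fin n → Config m n
add C p q a b = (does (a ≟ p) ∧ does (b ≟ q)) ∨ C a b

add-new : ∀ {m n} (C : Config m n) p q → Occ (add C p q) p q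
add-new C p q with p ≟ p | q ≟ q
... | yes _  | yes _  = refl
... | yes _  | no q≢q = contradiction refl q≢q
... | no p≢p | _      = contradiction refl p≢p

add-⊇ : ∀ {m n} (C : Config m n) p q → C ⊆C add C p q
add-⊇ C p q a b occ rewrite occ = ∨-zeroʳ _

add-cases : ∀ {m n} (C : Config m n) p q {a b} →
  Occ (add C p q) a b → (a ≡ p × b ≡ q) ⊎ Occ C a b
add-cases C p q {a} {b} occ with a ≟ p | b ≟ q
... | yes a≡p | yes b≡q = inj₁ (a≡p , b≡q)
... | yes _   | no _    = inj₂ occ
... | no _    | _       = inj₂ occ

add-old : ∀ {m n} (C : Config m n) p q {a b} →
  Occ (add C p q) a b → ¬ (a ≡ p × b ≡ q) → Occ C a b
add-old C p q occ ≢pq with add-cases C p q occ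
... | inj₁ ≡pq = contradiction ≡pq ≢pq
... | inj₂ old = old

-- The only ways in which maximality can be met at the lot (p , q); the conclusion is an
-- arbitrary boolean, so that the case distinction is constructive.
maximal-cases : ∀ {m n} (C : Config m n) → Maximal C → ∀ p q → (let i = toℕ p; j = toℕ q; X = grid C) →
  ∀ b →
  (T (X (1 + i) (2 + j)) → T b) →
  (T (X i (1 + j)) → T (X i (2 + j)) → T (X i (3 + j)) → T b) →
  (T (X (1 + i) (1 + j)) → T (X (1 + i) (3 + j)) → T (X (2 + i) (2 + j)) → T b) →
  (T (X (1 + i) j) → T (X (1 + i) (1 + j)) → T (X (2 + i) (1 + j)) → T b) →
  (T (X (1 + i) (3 + j)) → T (X (1 + i) (4 + j)) → T (X (2 + i) (3 + j)) → T b) →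
  T b
maximal-cases C (perm , max) p q b here north self west east =
  -- If `b` failed, the added house would block nothing, so maximality would make the lot occupied
  -- already and `here` would give `b`.
  decidable-stable (T? b) λ ¬b → ¬b $ here $ occupied C refl refl $
    max (add C p q) (λ a c → blocked ¬b a c) (add-⊇ C p q) p q (add-new C p q)
  where
  blocked : ¬ T b → ∀ a c → ¬ Blocked (add C p q) a c
  blocked ¬b a c (h , (e , e≡ , he) , (w , w≡ , hw) , (s , s≡ , hs))
    with add-cases C p q h | add-cases C p q he | add-cases C p q hw | add-cases C p q hs
  -- The new house is in turn the blocked house, its eastern, its western and its southern
  -- neighbour; the blocked house then lies at, west of, east of or north of the new lot. If it is
  -- none of these, `C` itself has a blocked house.
  ... | inj₁ (refl , refl) | _ | _ | _ = ¬b $ self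
    (occupied C refl (cong suc w≡) (add-old C p q hw λ (_ , w≡q) → <⇒≢ w<c (cong toℕ w≡q)))
    (occupied C refl (cong (2 +_) e≡) (add-old C p q he λ (_ , e≡q) → <⇒≢ c<e (cong toℕ (sym e≡q))))
    (occupied C (cong suc s≡) refl (add-old C p q hs λ (s≡p , _) → <⇒≢ a<s (cong toℕ (sym s≡p))))
    where
    w<c = ≤-reflexive w≡
    c<e = ≤-reflexive (sym e≡)
    a<s = ≤-reflexive (sym s≡)
  ... | inj₂ h′ | inj₁ (refl , refl) | _ | _ = ¬b $ west
    (occupied C refl (trans (cong suc w≡) (sym e≡))
      (add-old C p q hw λ (_ , w≡q) → <⇒≢ w<e (cong toℕ w≡q)))
    (occupied C refl (cong suc (sym e≡)) h′)
    (occupied C (cong suc s≡) (cong suc (sym e≡))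
      (add-old C p q hs λ (s≡p , _) → <⇒≢ a<s (cong toℕ (sym s≡p))))
    where
    w<e = <-trans (≤-reflexive w≡) (≤-reflexive (sym e≡))
    a<s = ≤-reflexive (sym s≡)
  ... | inj₂ h′ | inj₂ e′ | inj₁ (refl , refl) | _ = ¬b $ east
    (occupied C refl (cong (2 +_) (sym w≡)) h′)
    (occupied C refl (cong (2 +_) (trans e≡ (cong suc (sym w≡)))) e′)
    (occupied C (cong suc s≡) (cong (2 +_) (sym w≡))
      (add-old C p q hs λ (s≡p , _) → <⇒≢ a<s (cong toℕ (sym s≡p))))
    where
    a<s = ≤-reflexive (sym s≡)
  ... | inj₂ h′ | inj₂ e′ | inj₂ w′ | inj₁ (refl , refl) = ¬b $ north
    (occupied C (sym s≡) (cong suc w≡) w′)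
    (occupied C (sym s≡) refl h′)
    (occupied C (sym s≡) (cong (2 +_) e≡) e′)
  ... | inj₂ h′ | inj₂ e′ | inj₂ w′ | inj₂ s′ =
    perm a c (h′ , (e , e≡ , e′) , (w , w≡ , w′) , (s , s≡ , s′))

∨-left : ∀ {a b} → T a → T (a ∨ b)
∨-left = Equivalence.from T-∨ ∘ inj₁

∨-right : ∀ a {b} → T b → T (a ∨ b)
∨-right a = Equivalence.from (T-∨ {a}) ∘ inj₂

∧-both : ∀ {a b} → T a → T b → T (a ∧ b)
∧-both a b = Equivalence.from T-∧ (a , b)

module _ {m n} (C : Config m n) (max : Maximal C) where

  private X = grid C

  justified-Fin : ∀ p q → Justified (X (toℕ p)) (X (suc (toℕ p))) (toℕ q)
  justified-Fin p q = maximal-cases C max p q _ ∨-left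
    (λ w h e → ∨-right x (∨-left (∧-both w (∧-both h e))))
    (λ w e _ → ∨-right x (∨-right north (∨-left (∧-both w e))))
    (λ w h _ → ∨-right x (∨-right north (∨-right self (∨-left (∧-both w h)))))
    (λ h e _ → ∨-right x (∨-right north (∨-right self (∨-right west (∧-both h e)))))
    where
    i = toℕ p
    j = toℕ q
    x = X (1 + i) (2 + j)
    north = interior (X i) (1 + j)
    self = X (1 + i) (1 + j) ∧ X (1 + i) (3 + j)
    west = X (1 + i) j ∧ X (1 + i) (1 + j)

  grid-justified : ∀ i j → i < m → j < n → Justified (X i) (X (suc i)) j
  grid-justified i j i<m j<n =
    subst₂ (λ i j → Justified (X i) (X (suc i)) j)
           (toℕ-fromℕ< i<m) (toℕ-fromℕ< j<n) (justified-Fin (fromℕ< i<m) (fromℕ< j<n))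

  -- Only a house of the northern neighbour can be blocked from the last row.
  last-row-Fin : ∀ p q → m ≤ suc (toℕ p) →
    T (X (suc (toℕ p)) (2 + toℕ q) ∨ interior (X (toℕ p)) (1 + toℕ q))
  last-row-Fin p q last = maximal-cases C max p q _ ∨-left
    (λ w h e → ∨-right (X (suc (toℕ p)) (2 + toℕ q)) (∧-both w (∧-both h e)))
    (λ _ _ → below (2 + toℕ q)) (λ _ _ → below (1 + toℕ q)) (λ _ _ → below (3 + toℕ q))
    where
    below : ∀ j {A : Set} → T (X (2 + toℕ p) j) → A
    below j south = contradiction (subst T (grid-below C (suc (toℕ p)) j last) south) λ ()

  last-row : ∀ i j → m ≡ suc i → j < n → T (X (suc i) (2 + j) ∨ interior (X i) (1 + j))
  last-row i j refl j<n =
    subst₂ (λ i j → m ≤ suc i → T (X (suc i) (2 + j) ∨ interior (X i) (1 + j)))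
           (toℕ-fromℕ< ≤-refl) (toℕ-fromℕ< j<n) (last-row-Fin (fromℕ< {i} ≤-refl) (fromℕ< j<n)) ≤-refl

-- Assembling the bounds by residue modulo 4.

middle-empty : ∀ k → middle (const false) k ≡ 0
middle-empty zero    = refl
middle-empty (suc k) = middle-empty k

occupancy-bound : ∀ k q r (C : Config (2 + k) (q * 4 + toℕ r)) → Maximal C → 2 ≤ q * 4 + toℕ r →
  k * (q * 2 + tail r) + ((q * 4 + toℕ r) + 2) ≤ occupancy C
occupancy-bound k q r C max 2≤n = begin
  k * (q * 2 + tail r) + (n + 2)
    ≤⟨ telescope (q * 2 + tail r) (n + 2) k houses (λ i → middle (X i) (suc q)) step
         (last-rows n (X k) (X (1 + k)) (X (2 + k)) 2≤n (grid-bordered C k) (grid-bordered C (1 + k))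
           (λ j → grid-justified C max k j (s≤s (n≤1+n k)))
           (λ j → last-row C max (suc k) j refl)) ⟩
  -- The first row receives no credit, since row 0 is the empty row north of the grid.
  total houses (2 + k) + middle (X 0) (suc q)  ≡⟨ cong (total houses (2 + k) +_) (middle-empty q) ⟩
  total houses (2 + k) + 0                     ≡⟨ +-identityʳ _ ⟩
  total houses (2 + k)                         ≡⟨ occupancy-grid C ⟨
  occupancy C                                  ∎
  where
  open ≤-Reasoning
  n = q * 4 + toℕ r
  X = grid C
  houses : ℕ → ℕ
  houses i = count (X (suc i) ∘ (2 +_)) n
  step : ∀ i → i < k → q * 2 + tail r + middle (X (suc i)) (suc q) ≤ houses i + middle (X i) (suc q)
  -- Index 1 of a padded row computes to `false`, so the count in `row-bound` reduces to `houses i`.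
  step i i<k = row-bound q r (X i) (X (suc i))
    (λ j → grid-justified C max i j (≤-trans i<k (m≤n+m k 2)))
    (proj₂ (grid-bordered C (suc i)))

-- All three bounds are doubled to avoid fractions.
Bounds : ℕ → ℕ → ℕ → Set
Bounds m n I =
  (n % 4 ≡ 0 → m * n + 4 ≤ 2 * I) ×
  (n % 4 ≡ 2 → m * (n + 2) ≤ 2 * I) ×
  (n % 2 ≡ 1 → m * (n + 1) + 2 ≤ 2 * I)

%4-residue : ∀ q (r : Fin 4) → (q * 4 + toℕ r) % 4 ≡ toℕ r % 4
%4-residue q r = trans (cong (_% 4) (+-comm (q * 4) (toℕ r))) ([m+kn]%n≡m%n (toℕ r) q 4)

%2-residue : ∀ q (r : Fin 4) → (q * 4 + toℕ r) % 2 ≡ toℕ r % 4 % 2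
%2-residue q r =
  trans (sym (m∣n⇒o%n%m≡o%m 2 4 (q * 4 + toℕ r) (divides 2 refl))) (cong (_% 2) (%4-residue q r))

other-residue : ∀ {x a b : ℕ} {A : Set} → x ≡ a → ¬ (a ≡ b) → x ≡ b → A
other-residue x≡a a≢b x≡b = contradiction (trans (sym x≡a) x≡b) a≢b

doubled : ∀ {a b c} → a ≡ 2 * b → b ≤ c → a ≤ 2 * c
doubled refl = *-monoʳ-≤ 2

-- With `n = q * 4 + toℕ r`, the row average `q * 2 + tail r` is n/2, (n+1)/2, (n+2)/2, (n+1)/2 for
-- r = 0, 1, 2, 3. Twice the assumed lower bound is then exactly the claimed one.
bounds : ∀ k q r I → k * (q * 2 + tail r) + ((q * 4 + toℕ r) + 2) ≤ I →
  Bounds (2 + k) (q * 4 + toℕ r) I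
bounds k q 0F I bound =
  (λ _ → doubled (identity k q) bound) ,
  other-residue (%4-residue q 0F) (λ ()) ,
  other-residue (%2-residue q 0F) (λ ())
  where
  identity : ∀ k q → (2 + k) * (q * 4 + 0) + 4 ≡ 2 * (k * (q * 2 + 0) + ((q * 4 + 0) + 2))
  identity = solve-∀
bounds k q 1F I bound =
  other-residue (%4-residue q 1F) (λ ()) ,
  other-residue (%4-residue q 1F) (λ ()) ,
  (λ _ → doubled (identity k q) bound)
  where
  identity : ∀ k q → (2 + k) * (q * 4 + 1 + 1) + 2 ≡ 2 * (k * (q * 2 + 1) + ((q * 4 + 1) + 2))
  identity = solve-∀
bounds k q 2F I bound =
  other-residue (%4-residue q 2F) (λ ()) ,
  (λ _ → doubled (identity k q) bound) ,
  other-residue (%2-residue q 2F) (λ ())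
  where
  identity : ∀ k q → (2 + k) * (q * 4 + 2 + 2) ≡ 2 * (k * (q * 2 + 2) + ((q * 4 + 2) + 2))
  identity = solve-∀
bounds k q 3F I bound =
  other-residue (%4-residue q 3F) (λ ()) ,
  other-residue (%4-residue q 3F) (λ ()) ,
  (λ _ → doubled (identity k q) bound)
  where
  identity : ∀ k q → (2 + k) * (q * 4 + 3 + 1) + 2 ≡ 2 * (k * (q * 2 + 2) + ((q * 4 + 3) + 2))
  identity = solve-∀

maximal-bounds : ∀ m n → 2 ≤ m → 2 ≤ n → (C : Config m n) → Maximal C → Bounds m n (occupancy C)
maximal-bounds (suc (suc k)) n (s≤s (s≤s z≤n)) 2≤n C max with n divMod 4
-- With `q * 4` in front, the width at `suc q` computes to 4 plus the width at `q`, as the induction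
-- in `row-bound` requires.
... | result q r n≡ with trans n≡ (+-comm (toℕ r) (q * 4))
... | refl = bounds k q r (occupancy C) (occupancy-bound k q r C max 2≤n)

theorem4p5 : (m n : ℕ) → 2 ≤ m → 2 ≤ n →
    (C : Config m n) → Maximal C →
    (I : ℕ) → IsI m n I →
    I ≤ occupancy C
    × (n % 4 ≡ 0 → m * n + 4 ≤ 2 * I)
    × (n % 4 ≡ 2 → m * (n + 2) ≤ 2 * I)
    × (n % 2 ≡ 1 → m * (n + 1) + 2 ≤ 2 * I)
theorem4p5 m n 2≤m 2≤n C max I ((C₀ , max₀ , occ≡I) , minimal) =
  -- The bounds are applied to the minimiser `C₀`, whose occupancy is `I`.
  minimal C max , subst (Bounds m n) occ≡I (maximal-bounds m n 2≤m 2≤n C₀ max₀)
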